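{- The lattice of subvarieties of $\mathbf{DStHC}$ is the following $(\omega+1)$-chain: $$\mathbf{V(C_1^{dp})}<\mathbf{V(C_2^{dp})}<\dots<\mathbf{V(C_n^{dp})}<\dots<\mathbf{DStHC}.$$
   Context: A semi-Heyting algebra is an algebra $\langle L,\vee,\wedge,\to,0,1\rangle$ such that $\langle L,\vee,\wedge,0,1\rangle$ is a bounded lattice and the identities $x\wedge(x\to y)\approx x\wedge y$, $x\wedge(y\to z)\approx x\wedge[(x\wedge y)\to(x\wedge z)]$, $x\to x\approx 1$ hold; it is a Heyting algebra if moreover $(x\wedge y)\to y\approx 1$. A $\mathbf{DQD}$-algebra is an algebra $\langle L,\vee,\wedge,\to,{}',0,1\rangle$ whose reduct $\langle L,\vee,\wedge,\to,0,1\rangle$ is a semi-Heyting algebra and which satisfies: $0'\approx 1$ and $1'\approx 0$; $(x\wedge y)'\approx x'\vee y'$; $(x\vee y)''\approx x''\vee y''$; $x''\le x$. A dually Stone Heyting algebra is a $\mathbf{DQD}$-algebra whose semi-Heyting reduct is a Heyting algebra and which satisfies $x'\wedge x''\approx 0$; a dually Stone Heyting chain is one whose lattice reduct is a chain. $\mathbf{DStHC}$ is the variety generated by all dually Stone Heyting chains. For $n\in\mathbb{N}=\{1,2,\dots\}$, $\mathbf{C_n^{dp}}$ is the (unique up to isomorphism) $n$-element dually Stone Heyting chain (in it, $x'=1$ for $x\neq 1$ and $1'=0$), and $\mathbf{V(C_n^{dp})}$ is the variety it generates ($\mathbf{C_1^{dp}}$ is the trivial algebra). -}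

module Defs where

open import Level using (Level; 0ℓ; suc) renaming (_⊔_ to _⊔ˡ_)
open import Algebra.Core using (Op₁; Op₂)
import Algebra.Construct.NaturalChoice.Max as Max
import Algebra.Construct.NaturalChoice.Min as Min
import Algebra.Definitions as AlgDefs
import Algebra.Lattice.Construct.NaturalChoice.MinMaxOp as MinMaxLattice
import Algebra.Lattice.Structures as AlgLattice
open import Data.Empty using (⊥-elim)
open import Data.Fin.Base as Fin using (Fin; fromℕ)
import Data.Fin.Properties as Fin
open import Data.Nat.Base as ℕ using (ℕ; NonZero)
open import Data.Product.Base using (∃; _×_; _,_; proj₁; proj₂)
open import Data.Sum.Base using (_⊎_; inj₁; inj₂; [_,_]′)
open import Relation.Binary.Core using (Rel)
open import Relation.Binary.Definitions using (Total)
open import Relation.Binary.Lattice.Bundles using (Lattice)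
open import Relation.Binary.PropositionalEquality.Core using (_≡_; refl; sym; trans; cong; cong₂)
open import Relation.Binary.PropositionalEquality.Properties using (isEquivalence)
open import Relation.Binary.Structures using (IsEquivalence)
open import Relation.Nullary using (¬_; yes; no)
open import Relation.Nullary.Construct.Add.Supremum public using (_⁺; [_]; ⊤⁺)
open import Relation.Binary.Construct.Add.Supremum.NonStrict ℕ._≤_ public using (_≤⁺_)
open import Relation.Unary using (Pred; _∈_; _⊆_; _≐_; _∪_; _∩_; ｛_｝)

-- Carriers are setoids: _≈_ plays the role of equality.
record Algebra : Set (suc 0ℓ) where
  infix  4 _≈_ _≤_
  infixr 5 _⇒_
  infixr 6 _∨_
  infixr 7 _∧_
  infix  8 _′
  field
    Carrier         : Set
    _≈_             : Rel Carrier 0ℓ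
    ≈-isEquivalence : IsEquivalence _≈_
    _∨_ _∧_ _⇒_     : Op₂ Carrier
    _′              : Op₁ Carrier
    0# 1#           : Carrier
    ∨-congruent     : AlgDefs.Congruent₂ _≈_ _∨_
    ∧-congruent     : AlgDefs.Congruent₂ _≈_ _∧_
    ⇒-congruent     : AlgDefs.Congruent₂ _≈_ _⇒_
    ′-congruent     : AlgDefs.Congruent₁ _≈_ _′

  _≤_ : Rel Carrier 0ℓ
  x ≤ y = x ∧ y ≈ x

module _ (A : Algebra) where
  open Algebra A

  record IsSemiHeyting : Set where
    field
      isLattice   : AlgLattice.IsLattice _≈_ _∨_ _∧_
      ∨-identity  : AlgDefs.Identity _≈_ 0# _∨_
      ∧-identity  : AlgDefs.Identity _≈_ 1# _∧_
      x∧[x⇒y]≈x∧y : ∀ x y → x ∧ (x ⇒ y) ≈ x ∧ y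
      x∧[y⇒z]     : ∀ x y z → x ∧ (y ⇒ z) ≈ x ∧ ((x ∧ y) ⇒ (x ∧ z))
      x⇒x≈1       : ∀ x → x ⇒ x ≈ 1#

  record IsHeyting : Set where
    field
      isSemiHeyting : IsSemiHeyting
      [x∧y]⇒y≈1     : ∀ x y → (x ∧ y) ⇒ y ≈ 1#

  record IsDQD : Set where
    field
      isSemiHeyting : IsSemiHeyting
      0′≈1          : 0# ′ ≈ 1#
      1′≈0          : 1# ′ ≈ 0#
      [x∧y]′≈x′∨y′  : ∀ x y → (x ∧ y) ′ ≈ x ′ ∨ y ′
      [x∨y]″≈x″∨y″  : ∀ x y → ((x ∨ y) ′) ′ ≈ (x ′) ′ ∨ (y ′) ′
      x″≤x          : ∀ x → (x ′) ′ ≤ x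

  record IsDuallyStoneHeyting : Set where
    field
      isDQD     : IsDQD
      isHeyting : IsHeyting
      x′∧x″≈0   : ∀ x → x ′ ∧ (x ′) ′ ≈ 0#

  record IsDuallyStoneHeytingChain : Set where
    field
      isDuallyStoneHeyting : IsDuallyStoneHeyting
      ≤-total              : Total _≤_

infixr 5 _`⇒_
infixr 6 _`∨_
infixr 7 _`∧_
infix  8 _`′

data Term : Set where
  var            : ℕ → Term
  _`∨_ _`∧_ _`⇒_ : Term → Term → Term
  _`′            : Term → Term
  `0 `1          : Term

module _ (A : Algebra) where
  open Algebra A

  ⟦_⟧ : Term → (ℕ → Carrier) → Carrier
  ⟦ var i  ⟧ ρ = ρ i
  ⟦ s `∨ t ⟧ ρ = ⟦ s ⟧ ρ ∨ ⟦ t ⟧ ρ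
  ⟦ s `∧ t ⟧ ρ = ⟦ s ⟧ ρ ∧ ⟦ t ⟧ ρ
  ⟦ s `⇒ t ⟧ ρ = ⟦ s ⟧ ρ ⇒ ⟦ t ⟧ ρ
  ⟦ s `′   ⟧ ρ = (⟦ s ⟧ ρ) ′
  ⟦ `0     ⟧ ρ = 0#
  ⟦ `1     ⟧ ρ = 1#

Equation : Set
Equation = Term × Term

infix 4 _⊨_

_⊨_ : Algebra → Equation → Set
A ⊨ (s , t) = ∀ ρ → Algebra._≈_ A (⟦_⟧ A s ρ) (⟦_⟧ A t ρ)

private variable
  ℓ : Level

Mod : Pred Equation ℓ → Pred Algebra ℓ
Mod E A = ∀ e → e ∈ E → A ⊨ e

Id : Pred Algebra ℓ → Pred Equation (suc 0ℓ ⊔ˡ ℓ)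
Id K e = ∀ A → A ∈ K → A ⊨ e

-- Id K quantifies over all algebras, so equation sets defining varieties
-- are allowed to live in Set₁.
Class : Set (suc (suc 0ℓ))
Class = Pred Algebra (suc 0ℓ)

-- A variety is an equational class.
IsVariety : Class → Set (suc (suc 0ℓ))
IsVariety K = ∃ λ (E : Pred Equation (suc 0ℓ)) → K ≐ Mod E

-- The variety generated by K: by V-isVariety, ⊆-V and V-least below it is
-- the smallest variety containing K.
V : Pred Algebra ℓ → Pred Algebra (suc 0ℓ ⊔ˡ ℓ)
V K = Mod (Id K)

V-isVariety : (K : Class) → IsVariety (V K)
V-isVariety K = Id K , (λ m → m) , (λ m → m)

⊆-V : (K : Pred Algebra ℓ) → K ⊆ V K
⊆-V K {A} A∈K e e∈Id = e∈Id A A∈K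

V-least : (K : Pred Algebra ℓ) {W : Class} → IsVariety W → K ⊆ W → V K ⊆ W
V-least K (E , W⊆ , ⊆W) K⊆W A∈V = ⊆W λ e e∈E → A∈V e λ B B∈K → W⊆ (K⊆W B∈K) e e∈E

record Subvariety (W : Class) : Set (suc (suc 0ℓ)) where
  field
    class     : Class
    isVariety : IsVariety class
    ⊆-base    : class ⊆ W

module _ {W : Class} (W-isVariety : IsVariety W) where
  open Subvariety

  private
    _∨ˢ_ _∧ˢ_ : Op₂ (Subvariety W)
    X ∨ˢ Y = record
      { class     = V (class X ∪ class Y)
      ; isVariety = V-isVariety (class X ∪ class Y)
      ; ⊆-base    = V-least (class X ∪ class Y) W-isVariety [ ⊆-base X , ⊆-base Y ]′
      }
    X ∧ˢ Y = record
      { class     = class X ∩ class Y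
      ; isVariety =
          let (E , X⊆ , ⊆X) = isVariety X ; (F , Y⊆ , ⊆Y) = isVariety Y in
          E ∪ F
          , (λ (x , y) → λ { e (inj₁ i) → X⊆ x e i ; e (inj₂ j) → Y⊆ y e j })
          , (λ m → ⊆X (λ e i → m e (inj₁ i)) , ⊆Y (λ e j → m e (inj₂ j)))
      ; ⊆-base    = λ (x , _) → ⊆-base X x
      }

  subvarietyLattice : Lattice (suc (suc 0ℓ)) (suc 0ℓ) (suc 0ℓ)
  subvarietyLattice = record
    { Carrier   = Subvariety W
    ; _≈_       = λ X Y → class X ≐ class Y
    ; _≤_       = λ X Y → class X ⊆ class Y
    ; _∨_       = _∨ˢ_
    ; _∧_       = _∧ˢ_
    ; isLattice = record
      { isPartialOrder = record
        { isPreorder = record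
          { isEquivalence = record
            { refl  = (λ x → x) , (λ x → x)
            ; sym   = λ (p , q) → q , p
            ; trans = λ (p , q) (r , s) → (λ x → r (p x)) , (λ x → q (s x))
            }
          ; reflexive = proj₁
          ; trans     = λ p q x → q (p x)
          }
        ; antisym = λ p q → p , q
        }
      ; supremum = λ X Y →
            (λ {A} x → ⊆-V (class X ∪ class Y) {A} (inj₁ x))
          , (λ {A} y → ⊆-V (class X ∪ class Y) {A} (inj₂ y))
          , (λ Z p q → V-least (class X ∪ class Y) (isVariety Z) [ p , q ]′)
      ; infimum = λ X Y → proj₁ , proj₂ , (λ Z p q z → p z , q z)
      }
    }

module FinChain (k : ℕ) where
  open Min (Fin.≤-totalOrder (ℕ.suc k)) using (_⊓_; minOperator; x≤y⇒x⊓y≈x; x≤y⇒y⊓x≈x; x⊓y≤y)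
  open Max (Fin.≤-totalOrder (ℕ.suc k)) using (_⊔_; maxOperator; x≤y⇒x⊔y≈y; x≤y⇒y⊔x≈y)

  L : Set
  L = Fin (ℕ.suc k)

  bot top : L
  bot = Fin.zero
  top = fromℕ k

  imp : Op₂ L
  imp x y with x Fin.≤? y
  ... | yes _ = top
  ... | no  _ = y

  dual : Op₁ L
  dual x with x Fin.≟ top
  ... | yes _ = bot
  ... | no  _ = top

  algebra : Algebra
  algebra = record
    { Carrier         = L
    ; _≈_             = _≡_
    ; ≈-isEquivalence = isEquivalence
    ; _∨_             = _⊔_
    ; _∧_             = _⊓_
    ; _⇒_             = imp
    ; _′              = dual
    ; 0#              = bot
    ; 1#              = top
    ; ∨-congruent     = cong₂ _⊔_
    ; ∧-congruent     = cong₂ _⊓_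
    ; ⇒-congruent     = cong₂ imp
    ; ′-congruent     = cong dual
    }

  bot≤ : ∀ (x : L) → bot Fin.≤ x
  bot≤ x = ℕ.z≤n

  ≤top : ∀ x → x Fin.≤ top
  ≤top = Fin.≤fromℕ

  imp-≤ : ∀ {x y} → x Fin.≤ y → imp x y ≡ top
  imp-≤ {x} {y} p with x Fin.≤? y
  ... | yes _ = refl
  ... | no ¬p = ⊥-elim (¬p p)

  imp-cases : ∀ x y → x Fin.≤ y ⊎ imp x y ≡ y
  imp-cases x y with x Fin.≤? y
  ... | yes p = inj₁ p
  ... | no _  = inj₂ refl

  dual-top : dual top ≡ bot
  dual-top with top Fin.≟ top
  ... | yes _ = refl
  ... | no ¬p = ⊥-elim (¬p refl)

  dual-bot : dual bot ≡ top
  dual-bot with bot Fin.≟ top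
  ... | yes p = p
  ... | no _  = refl

  dual-anti : ∀ {x y : L} → x Fin.≤ y → dual y Fin.≤ dual x
  dual-anti {x} {y} p with x Fin.≟ top | y Fin.≟ top
  ... | _        | yes _   = bot≤ _
  ... | no _     | no _    = Fin.≤-refl {x = top}
  ... | yes refl | no y≢⊤  = ⊥-elim (y≢⊤ (Fin.≤-antisym (≤top y) p))

  ⊓-top : ∀ x → x ⊓ top ≡ x
  ⊓-top x = x≤y⇒x⊓y≈x {x} {top} (≤top x)

  x∧imp : ∀ x y → x ⊓ imp x y ≡ x ⊓ y
  x∧imp x y = [ x≤y-case , cong (x ⊓_) ]′ (imp-cases x y)
    where
    x≤y-case : x Fin.≤ y → x ⊓ imp x y ≡ x ⊓ y
    x≤y-case p = trans (cong (x ⊓_) (imp-≤ p)) (trans (⊓-top x) (sym (x≤y⇒x⊓y≈x p)))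

  module _ {x y z : L} where
    ∧-imp₁ : x Fin.≤ y → x Fin.≤ z → x ⊓ imp y z ≡ x ⊓ imp (x ⊓ y) (x ⊓ z)
    ∧-imp₁ p r
      rewrite x≤y⇒x⊓y≈x p | x≤y⇒x⊓y≈x r | imp-≤ {x} Fin.≤-refl
      with y Fin.≤? z
    ... | yes _ = refl
    ... | no _  = trans (x≤y⇒x⊓y≈x r) (sym (⊓-top x))

    ∧-imp₂ : x Fin.≤ y → z Fin.≤ x → x ⊓ imp y z ≡ x ⊓ imp (x ⊓ y) (x ⊓ z)
    ∧-imp₂ p r
      rewrite x≤y⇒x⊓y≈x p | x≤y⇒y⊓x≈x r | x∧imp x z
      with y Fin.≤? z
    ... | yes q = trans (⊓-top x) (sym (x≤y⇒x⊓y≈x (Fin.≤-trans p q)))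
    ... | no _  = refl

    ∧-imp₃ : y Fin.≤ x → x Fin.≤ z → x ⊓ imp y z ≡ x ⊓ imp (x ⊓ y) (x ⊓ z)
    ∧-imp₃ q r
      rewrite x≤y⇒y⊓x≈x q | x≤y⇒x⊓y≈x r | imp-≤ q | imp-≤ (Fin.≤-trans q r) = refl

    ∧-imp₄ : y Fin.≤ x → z Fin.≤ x → x ⊓ imp y z ≡ x ⊓ imp (x ⊓ y) (x ⊓ z)
    ∧-imp₄ q r rewrite x≤y⇒y⊓x≈x q | x≤y⇒y⊓x≈x r = refl

  ∧-imp : ∀ x y z → x ⊓ imp y z ≡ x ⊓ imp (x ⊓ y) (x ⊓ z)
  ∧-imp x y z =
    [ (λ p → [ ∧-imp₁ p , ∧-imp₂ p ]′ (Fin.≤-total x z))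
    , (λ q → [ ∧-imp₃ q , ∧-imp₄ q ]′ (Fin.≤-total x z))
    ]′ (Fin.≤-total x y)

  dual-∧ : ∀ x y → dual (x ⊓ y) ≡ dual x ⊔ dual y
  dual-∧ x y =
    [ (λ p → trans (cong dual (x≤y⇒x⊓y≈x p)) (sym (x≤y⇒y⊔x≈y (dual-anti p))))
    , (λ q → trans (cong dual (x≤y⇒y⊓x≈x q)) (sym (x≤y⇒x⊔y≈y (dual-anti q))))
    ]′ (Fin.≤-total x y)

  dual²-∨ : ∀ x y → dual (dual (x ⊔ y)) ≡ dual (dual x) ⊔ dual (dual y)
  dual²-∨ x y =
    [ (λ p → trans (cong (λ z → dual (dual z)) (x≤y⇒x⊔y≈y p))
                   (sym (x≤y⇒x⊔y≈y (dual-anti (dual-anti p)))))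
    , (λ q → trans (cong (λ z → dual (dual z)) (x≤y⇒y⊔x≈y q))
                   (sym (x≤y⇒y⊔x≈y (dual-anti (dual-anti q)))))
    ]′ (Fin.≤-total x y)

  dual²-≤ : ∀ x → dual (dual x) Fin.≤ x
  dual²-≤ x with x Fin.≟ top
  ... | yes refl = ≤top _
  ... | no _ rewrite dual-top = bot≤ x

  dual-stone : ∀ x → dual x ⊓ dual (dual x) ≡ bot
  dual-stone x with x Fin.≟ top
  ... | yes _ = x≤y⇒x⊓y≈x (bot≤ (dual bot))
  ... | no _ rewrite dual-top = x≤y⇒y⊓x≈x (bot≤ top)

  isSemiHeyting : IsSemiHeyting algebra
  isSemiHeyting = record
    { isLattice   = MinMaxLattice.⊔-⊓-isLattice minOperator maxOperator
    ; ∨-identity  = (λ x → x≤y⇒x⊔y≈y {x} {bot} (bot≤ x)) , (λ x → x≤y⇒y⊔x≈y {x} {bot} (bot≤ x))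
    ; ∧-identity  = (λ x → x≤y⇒y⊓x≈x {x} {top} (≤top x)) , ⊓-top
    ; x∧[x⇒y]≈x∧y = x∧imp
    ; x∧[y⇒z]     = ∧-imp
    ; x⇒x≈1       = λ x → imp-≤ {x} Fin.≤-refl
    }

  isDuallyStoneHeytingChain : IsDuallyStoneHeytingChain algebra
  isDuallyStoneHeytingChain = record
    { isDuallyStoneHeyting = record
      { isDQD = record
        { isSemiHeyting = isSemiHeyting
        ; 0′≈1          = dual-bot
        ; 1′≈0          = dual-top
        ; [x∧y]′≈x′∨y′  = dual-∧
        ; [x∨y]″≈x″∨y″  = dual²-∨
        ; x″≤x          = λ x → x≤y⇒x⊓y≈x {dual (dual x)} {x} (dual²-≤ x)
        }
      ; isHeyting = record
        { isSemiHeyting = isSemiHeyting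
        ; [x∧y]⇒y≈1     = λ x y → imp-≤ (x⊓y≤y x y)
        }
      ; x′∧x″≈0 = dual-stone
      }
    ; ≤-total = λ x y →
        [ (λ p → inj₁ (x≤y⇒x⊓y≈x p)) , (λ q → inj₂ (x≤y⇒x⊓y≈x q)) ]′ (Fin.≤-total x y)
    }

-- The n-element chain, with carrier Fin n.
Cᵈᵖ : (n : ℕ) → .{{NonZero n}} → Algebra
Cᵈᵖ (ℕ.suc k) = FinChain.algebra k

Cᵈᵖ-isChain : ∀ n → .{{_ : NonZero n}} → IsDuallyStoneHeytingChain (Cᵈᵖ n)
Cᵈᵖ-isChain (ℕ.suc k) = FinChain.isDuallyStoneHeytingChain k

DStHC : Class
DStHC = V IsDuallyStoneHeytingChain

DStHC-isVariety : IsVariety DStHC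
DStHC-isVariety = Id IsDuallyStoneHeytingChain , (λ m → m) , (λ m → m)

subvarietiesOfDStHC : Lattice (suc (suc 0ℓ)) (suc 0ℓ) (suc 0ℓ)
subvarietiesOfDStHC = subvarietyLattice DStHC-isVariety

V⟨Cᵈᵖ_⟩ : (n : ℕ) → .{{NonZero n}} → Subvariety DStHC
V⟨Cᵈᵖ n ⟩ = record
  { class     = V ｛ Cᵈᵖ n ｝
  ; isVariety = V-isVariety ｛ Cᵈᵖ n ｝
  ; ⊆-base    = λ {A} → V-least ｛ Cᵈᵖ n ｝ DStHC-isVariety
                  (λ { refl → ⊆-V IsDuallyStoneHeytingChain {Cᵈᵖ n} (Cᵈᵖ-isChain n) }) {A}
  }

-- ℕ ⁺ with _≤⁺_ is the ordinal ω + 1; position k < ω holds the variety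
-- generated by the (k + 1)-element chain, since chains start at n = 1.
chain : ℕ ⁺ → Subvariety DStHC
chain [ k ] = V⟨Cᵈᵖ ℕ.suc k ⟩
chain ⊤⁺    = record
  { class     = DStHC
  ; isVariety = DStHC-isVariety
  ; ⊆-base    = λ {A} A∈ → A∈
  }

{-# OPTIONS --safe #-}
module Submission where

-- Write Cₙ for the chain with n elements. The proof rests on three facts.
--
-- Finite factorization. In a dually Stone Heyting chain B every element
-- x ≉ 1 satisfies x′ ≈ 1, and x ⇒ y is 1 or y, so that any set containing
-- 0 and 1 is a subalgebra. Hence a valuation in B of finitely many variables
-- takes its values in a copy of some Cₙ inside B, all of whose elements are
-- values of the terms 0, 1 and those variables (generate). An equation that
-- holds in all finite chains therefore holds in all chains
-- (finChains-generate).
--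
-- Strictness. Cₘ embeds in Cₙ for 2 ≤ m ≤ n, and C₁ satisfies everything,
-- so the varieties V(Cₙ) increase. The join of the implications
-- x₍ᵢ₊₁₎ ⇒ xᵢ, i < n, is 1 in Cₙ, because n + 1 elements of Cₙ cannot be
-- strictly increasing, and it is not 1 in the next longer chain when the xᵢ
-- enumerate that chain in increasing order (descent-valid, descent-refuted).
--
-- Entailment. Suppose that s ≈ t holds in Cₙ and that p ≈ q fails in the
-- next longer chain C at a valuation σ. In a chain the term Δ z = z″ is 1
-- where z is 1 and 0 elsewhere, so the assertion p ≈ q can be expressed
-- by the term Δ (p ⇔ q) with values 0 and 1. Let u be the conjunction of
-- these terms over the finitely many ways to replace the elements of C,
-- taken as variables through σ, by 0, 1 or a variable of s ≈ t. Then
-- u ∧ s ≈ u ∧ t holds in every chain: where s ≈ t fails, the values of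
-- its variables and the bounds form a chain too long to be contained in Cₙ,
-- so C embeds in it, some instance of p ≈ q fails, and u is 0
-- (entailment). The equation thus passes to every algebra A of the generated
-- variety; if A satisfies p ≈ q, then u is 1 in A, and s ≈ t follows.
--
-- Now let X be a subvariety. If X contains all finite chains, finite
-- factorization gives X = DStHC. Otherwise, since C₁ lies in X, some Cₙ lies
-- in X while the next chain does not, so an equation p ≈ q of X fails there;
-- by entailment every algebra in X satisfies every equation of Cₙ, whence
-- X = V(Cₙ). Excluded middle provides this case distinction and decides
-- equality and order in arbitrary chains.

open import Defs
open import Level using (0ℓ; suc; lift; lower)
open import Axiom.ExcludedMiddle using (ExcludedMiddle)
open import Data.Nat.Base using (ℕ)
open import Relation.Binary.Lattice.Bundles using (Lattice)
open import Relation.Binary.Morphism.Structures using (IsOrderIsomorphism)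
open import Relation.Binary.PropositionalEquality.Core using (_≡_)
import Algebra.Construct.NaturalChoice.Max as Max
import Algebra.Construct.NaturalChoice.Min as Min
open import Algebra.Lattice.Bundles using () renaming (Lattice to AlgebraicLattice)
import Algebra.Lattice.Properties.Lattice as LatticeProperties
open import Algebra.Lattice.Structures using (module IsLattice)
open import Data.Empty using (⊥-elim)
open import Data.Fin.Base as Fin using (Fin; fromℕ; fromℕ<; punchIn)
import Data.Fin.Properties as Fin
open import Data.List.Base using (List; []; _∷_; _++_; map; foldr; cartesianProductWith; length; lookup)
open import Data.List.Membership.Propositional using (_∈_)
import Data.List.Membership.DecPropositional as DecMembership
open import Data.List.Membership.Propositional.Properties
  using (∈-lookup; ∈-map⁺; ∈-++⁺ˡ; ∈-++⁺ʳ; ∈-cartesianProductWith⁺)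
open import Data.List.Relation.Binary.Subset.Propositional using (_⊆_)
open import Data.List.Relation.Unary.All as All using (All; []; _∷_)
open import Data.List.Relation.Unary.AllPairs using (AllPairs; []; _∷_)
open import Data.List.Relation.Unary.Any using (here; there; index)
open import Data.List.Relation.Unary.Any.Properties using (lookup-index)
import Data.Nat.Base as ℕ
import Data.Nat.Properties as ℕ
open import Data.Product.Base using (∃; _×_; _,_; proj₁; proj₂)
open import Data.Sum.Base using (_⊎_; inj₁; inj₂; [_,_]′)
open import Data.Vec.Base as Vec using (Vec)
import Data.Vec.Properties as Vec
open import Function.Base using (_∘_)
open import Relation.Binary.Construct.Add.Supremum.NonStrict ℕ._≤_ using ([_]; _≤⊤⁺; ≤⁺-antisym-≡)
open import Relation.Binary.Core using (Rel)
open import Relation.Binary.Bundles using (Setoid)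
open import Relation.Binary.Definitions using (Total; Transitive; Decidable; tri<; tri≈; tri>)
open import Relation.Binary.PropositionalEquality using (refl; sym; trans; cong; cong₂; subst; subst₂)
import Relation.Binary.Reasoning.Setoid as SetoidReasoning
open import Relation.Binary.Structures using (IsEquivalence)
open import Relation.Nullary using (¬_; Dec; yes; no)
open import Relation.Nullary.Decidable using (map′; decidable-stable)
open import Relation.Unary using (Pred; ｛_｝) renaming (_∈_ to _∈ᶜ_; _⊆_ to _⊆ᶜ_)

-- Order and dual pseudocomplement in a dually Stone Heyting chain

module ChainProperties {B : Algebra} (isChain : IsDuallyStoneHeytingChain B) where
  open Algebra B
  open IsDuallyStoneHeytingChain isChain public
  open IsDuallyStoneHeyting isDuallyStoneHeyting public
  open IsDQD isDQD public hiding (isSemiHeyting)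
  open IsHeyting isHeyting public
  open IsSemiHeyting isSemiHeyting public
  open IsLattice isLattice public
    using (∨-comm; ∧-comm; ∧-assoc; ∨-absorbs-∧; ∧-absorbs-∨)

  private
    latticeReduct : AlgebraicLattice 0ℓ 0ℓ
    latticeReduct = record { isLattice = isLattice }

  open LatticeProperties latticeReduct public using (∧-idem)

  setoid : Setoid 0ℓ 0ℓ
  setoid = record { isEquivalence = ≈-isEquivalence }

  open IsEquivalence ≈-isEquivalence public
    renaming (refl to ≈-refl; sym to ≈-sym; trans to ≈-trans; reflexive to ≈-reflexive)
  open SetoidReasoning setoid

  ≤-refl : ∀ {x} → x ≤ x
  ≤-refl {x} = ∧-idem x

  ≤-trans : Transitive _≤_
  ≤-trans {x} {y} {z} x≤y y≤z = begin
    x ∧ z        ≈⟨ ∧-congruent x≤y ≈-refl ⟨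
    (x ∧ y) ∧ z  ≈⟨ ∧-assoc x y z ⟩
    x ∧ (y ∧ z)  ≈⟨ ∧-congruent ≈-refl y≤z ⟩
    x ∧ y        ≈⟨ x≤y ⟩
    x            ∎

  ≤-antisym : ∀ {x y} → x ≤ y → y ≤ x → x ≈ y
  ≤-antisym {x} {y} x≤y y≤x = ≈-trans (≈-sym x≤y) (≈-trans (∧-comm x y) y≤x)

  ≤-reflexive : ∀ {x y} → x ≈ y → x ≤ y
  ≤-reflexive {x} x≈y = ≈-trans (∧-congruent ≈-refl (≈-sym x≈y)) (∧-idem x)

  ≤⇒∨≈ʳ : ∀ {x y} → x ≤ y → x ∨ y ≈ y
  ≤⇒∨≈ʳ {x} {y} x≤y = begin
    x ∨ y        ≈⟨ ∨-congruent x≤y ≈-refl ⟨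
    (x ∧ y) ∨ y  ≈⟨ ∨-congruent (∧-comm x y) ≈-refl ⟩
    (y ∧ x) ∨ y  ≈⟨ ∨-comm _ y ⟩
    y ∨ (y ∧ x)  ≈⟨ ∨-absorbs-∧ y x ⟩
    y            ∎

  ≤⇒∨≈ˡ : ∀ {x y} → y ≤ x → x ∨ y ≈ x
  ≤⇒∨≈ˡ {x} {y} y≤x = ≈-trans (∨-comm x y) (≤⇒∨≈ʳ y≤x)

  0∧x≈0 : ∀ x → 0# ∧ x ≈ 0#
  0∧x≈0 x = ≈-trans (∧-congruent ≈-refl (≈-sym (proj₁ ∨-identity x))) (∧-absorbs-∨ 0# x)

  x∧0≈0 : ∀ x → x ∧ 0# ≈ 0#
  x∧0≈0 x = ≈-trans (∧-comm x 0#) (0∧x≈0 x)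

  x≤1 : ∀ x → x ≤ 1#
  x≤1 = proj₂ ∧-identity

  1≤x⇒x≈1 : ∀ {x} → 1# ≤ x → x ≈ 1#
  1≤x⇒x≈1 = ≤-antisym (x≤1 _)

  ≤⇒⇒≈1 : ∀ {x y} → x ≤ y → x ⇒ y ≈ 1#
  ≤⇒⇒≈1 {x} {y} x≤y = ≈-trans (⇒-congruent (≈-sym x≤y) ≈-refl) ([x∧y]⇒y≈1 x y)

  ⇒≈1⇒≤ : ∀ {x y} → x ⇒ y ≈ 1# → x ≤ y
  ⇒≈1⇒≤ {x} {y} p = begin
    x ∧ y        ≈⟨ x∧[x⇒y]≈x∧y x y ⟨
    x ∧ (x ⇒ y)  ≈⟨ ∧-congruent ≈-refl p ⟩
    x ∧ 1#       ≈⟨ x≤1 x ⟩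
    x            ∎

  ≰⇒⇒≈ʳ : ∀ {x y} → ¬ (x ≤ y) → x ⇒ y ≈ y
  ≰⇒⇒≈ʳ {x} {y} x≰y with ≤-total x y | ≤-total x (x ⇒ y)
  ... | inj₁ x≤y | _      = ⊥-elim (x≰y x≤y)
  ... | inj₂ _   | inj₁ q = ⊥-elim (x≰y (≈-trans (≈-sym (x∧[x⇒y]≈x∧y x y)) q))
  ... | inj₂ y≤x | inj₂ q = begin
    x ⇒ y        ≈⟨ q ⟨
    (x ⇒ y) ∧ x  ≈⟨ ∧-comm _ x ⟩
    x ∧ (x ⇒ y)  ≈⟨ x∧[x⇒y]≈x∧y x y ⟩
    x ∧ y        ≈⟨ ∧-comm x y ⟩
    y ∧ x        ≈⟨ y≤x ⟩
    y            ∎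

  ′-antitone : ∀ {x y} → x ≤ y → y ′ ≤ x ′
  ′-antitone {x} {y} x≤y = begin
    y ′ ∧ x ′          ≈⟨ ∧-congruent ≈-refl (≈-trans (′-congruent (≈-sym x≤y)) ([x∧y]′≈x′∨y′ x y)) ⟩
    y ′ ∧ (x ′ ∨ y ′)  ≈⟨ ∧-congruent ≈-refl (∨-comm _ _) ⟩
    y ′ ∧ (y ′ ∨ x ′)  ≈⟨ ∧-absorbs-∨ _ _ ⟩
    y ′                ∎

  -- By totality x′ ∧ x″ ≈ 0 forces x′ ≈ 0 or x″ ≈ 0; the former gives
  -- 1 ≈ x″ ≤ x, the latter 1 ≈ x‴ ≤ x′.
  ≉1⇒′≈1 : ∀ {x} → ¬ (x ≈ 1#) → x ′ ≈ 1#
  ≉1⇒′≈1 {x} x≉1 with ≤-total (x ′) ((x ′) ′)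
  ... | inj₁ p = ⊥-elim (x≉1 (1≤x⇒x≈1 (≤-trans (≤-reflexive (≈-sym x″≈1)) (x″≤x x))))
    where
    x″≈1 : (x ′) ′ ≈ 1#
    x″≈1 = ≈-trans (′-congruent (≈-trans (≈-sym p) (x′∧x″≈0 x))) 0′≈1
  ... | inj₂ p = 1≤x⇒x≈1 (≤-trans (≤-reflexive (≈-sym x‴≈1)) (x″≤x (x ′)))
    where
    x‴≈1 : ((x ′) ′) ′ ≈ 1#
    x‴≈1 = ≈-trans (′-congruent (≈-trans (≈-sym p) (≈-trans (∧-comm _ _) (x′∧x″≈0 x)))) 0′≈1

  ≉1⇒″≈0 : ∀ {x} → ¬ (x ≈ 1#) → (x ′) ′ ≈ 0#
  ≉1⇒″≈0 x≉1 = ≈-trans (′-congruent (≉1⇒′≈1 x≉1)) 1′≈0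

  -- Strictness is stated as in an Embedding, below.
  strict⇒monotone : ∀ {n} {ι : Fin n → Carrier} →
                    (∀ {i j} → i Fin.< j → ¬ (ι j ≤ ι i)) →
                    ∀ {i j} → i Fin.≤ j → ι i ≤ ι j
  strict⇒monotone {ι = ι} strict {i} {j} i≤j with Fin.<-cmp i j
  ... | tri≈ _ refl _ = ≤-refl
  ... | tri> _ _ j<i  = ⊥-elim (ℕ.<⇒≱ j<i i≤j)
  ... | tri< i<j _ _  = [ (λ p → p) , (λ q → ⊥-elim (strict i<j q)) ]′ (≤-total (ι i) (ι j))

-- Embeddings of finite chains

-- A strictly increasing map from the chain with k + 1 elements to B that
-- preserves both bounds. Strictness is stated as the failure of the
-- reverse inequality, which is the right notion when B is totally ordered.
record Embedding (k : ℕ) (B : Algebra) : Set where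
  open Algebra B
  field
    ι        : Fin (ℕ.suc k) → Carrier
    ι-bot    : ι Fin.zero ≈ 0#
    ι-top    : ι (fromℕ k) ≈ 1#
    ι-strict : ∀ {i j} → i Fin.< j → ¬ (ι j ≤ ι i)

module EmbeddingProperties
  {k : ℕ} {B : Algebra} (isChain : IsDuallyStoneHeytingChain B) (emb : Embedding k B) where
  open Algebra B
  open ChainProperties isChain
  open Embedding emb
  open Min (Fin.≤-totalOrder (ℕ.suc k)) using (_⊓_; x≤y⇒x⊓y≈x; x≤y⇒y⊓x≈x)
  open Max (Fin.≤-totalOrder (ℕ.suc k)) using (_⊔_; x≤y⇒x⊔y≈y; x≤y⇒y⊔x≈y)
  open FinChain k using (algebra; imp; dual; top; ≤top)

  ι-mono : ∀ {i j} → i Fin.≤ j → ι i ≤ ι j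
  ι-mono = strict⇒monotone ι-strict

  ι-injective : ∀ {i j} → ι i ≈ ι j → i ≡ j
  ι-injective {i} {j} p with Fin.<-cmp i j
  ... | tri≈ _ i≡j _ = i≡j
  ... | tri< i<j _ _ = ⊥-elim (ι-strict i<j (≤-reflexive (≈-sym p)))
  ... | tri> _ _ j<i = ⊥-elim (ι-strict j<i (≤-reflexive p))

  ι-∨ : ∀ x y → ι (x ⊔ y) ≈ ι x ∨ ι y
  ι-∨ x y =
    [ (λ p → ≈-trans (≈-reflexive (cong ι (x≤y⇒x⊔y≈y p))) (≈-sym (≤⇒∨≈ʳ (ι-mono p))))
    , (λ q → ≈-trans (≈-reflexive (cong ι (x≤y⇒y⊔x≈y q))) (≈-sym (≤⇒∨≈ˡ (ι-mono q))))
    ]′ (Fin.≤-total x y)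

  ι-∧ : ∀ x y → ι (x ⊓ y) ≈ ι x ∧ ι y
  ι-∧ x y =
    [ (λ p → ≈-trans (≈-reflexive (cong ι (x≤y⇒x⊓y≈x p))) (≈-sym (ι-mono p)))
    , (λ q → ≈-trans (≈-reflexive (cong ι (x≤y⇒y⊓x≈x q)))
                     (≈-sym (≈-trans (∧-comm _ _) (ι-mono q))))
    ]′ (Fin.≤-total x y)

  ι-⇒ : ∀ x y → ι (imp x y) ≈ ι x ⇒ ι y
  ι-⇒ x y with x Fin.≤? y
  ... | yes p  = ≈-trans ι-top (≈-sym (≤⇒⇒≈1 (ι-mono p)))
  ... | no x≰y = ≈-sym (≰⇒⇒≈ʳ (ι-strict (ℕ.≰⇒> x≰y)))

  ι-′ : ∀ x → ι (dual x) ≈ (ι x) ′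
  ι-′ x with x Fin.≟ top
  ... | yes refl = ≈-trans ι-bot (≈-sym (≈-trans (′-congruent ι-top) 1′≈0))
  ... | no x≢⊤   = ≈-trans ι-top (≈-sym (≉1⇒′≈1 λ p → x≢⊤ (ι-injective (≈-trans p (≈-sym ι-top)))))

  ι-⟦⟧ : ∀ t σ → ι (⟦ algebra ⟧ t σ) ≈ ⟦ B ⟧ t (ι ∘ σ)
  ι-⟦⟧ (var i)  σ = ≈-refl
  ι-⟦⟧ (s `∨ t) σ = ≈-trans (ι-∨ _ _) (∨-congruent (ι-⟦⟧ s σ) (ι-⟦⟧ t σ))
  ι-⟦⟧ (s `∧ t) σ = ≈-trans (ι-∧ _ _) (∧-congruent (ι-⟦⟧ s σ) (ι-⟦⟧ t σ))
  ι-⟦⟧ (s `⇒ t) σ = ≈-trans (ι-⇒ _ _) (⇒-congruent (ι-⟦⟧ s σ) (ι-⟦⟧ t σ))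
  ι-⟦⟧ (t `′)   σ = ≈-trans (ι-′ _) (′-congruent (ι-⟦⟧ t σ))
  ι-⟦⟧ `0       σ = ι-bot
  ι-⟦⟧ `1       σ = ι-top

  ι-reflects : ∀ s t σ → ⟦ B ⟧ s (ι ∘ σ) ≈ ⟦ B ⟧ t (ι ∘ σ) →
               ⟦ algebra ⟧ s σ ≡ ⟦ algebra ⟧ t σ
  ι-reflects s t σ p = ι-injective (≈-trans (ι-⟦⟧ s σ) (≈-trans p (≈-sym (ι-⟦⟧ t σ))))

  ⊨-reflects : ∀ e → B ⊨ e → algebra ⊨ e
  ⊨-reflects (s , t) B⊨e σ = ι-reflects s t σ (B⊨e (ι ∘ σ))

finChain-≤ : ∀ {k} {x y : Fin (ℕ.suc k)} → Algebra._≤_ (FinChain.algebra k) x y → x Fin.≤ y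
finChain-≤ {k} {x} {y} x⊓y≡x = subst (Fin._≤ y) x⊓y≡x (x⊓y≤y x y)
  where open Min (Fin.≤-totalOrder (ℕ.suc k)) using (x⊓y≤y)

-- The image leaves out the second smallest element. This needs a chain with
-- at least two elements: the trivial chain, where 0 = 1, embeds in no
-- longer chain.
finChain-embedding-suc : ∀ k → Embedding (ℕ.suc k) (FinChain.algebra (ℕ.suc (ℕ.suc k)))
finChain-embedding-suc k = record
  { ι        = punchIn (Fin.suc Fin.zero)
  ; ι-bot    = refl
  ; ι-top    = refl
  ; ι-strict = λ {i} {j} i<j p →
      ℕ.<⇒≱ i<j (Fin.punchIn-cancel-≤ (Fin.suc Fin.zero) j i (finChain-≤ p))
  }

-- Composition of embeddings.
_∘ᴱ_ : ∀ {k l B} {isChain : IsDuallyStoneHeytingChain B} →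
       Embedding l B → Embedding k (FinChain.algebra l) → Embedding k B
_∘ᴱ_ {isChain = isChain} f g = record
  { ι        = F.ι ∘ G.ι
  ; ι-bot    = ≈-trans (≈-reflexive (cong F.ι G.ι-bot)) F.ι-bot
  ; ι-top    = ≈-trans (≈-reflexive (cong F.ι G.ι-top)) F.ι-top
  ; ι-strict = λ {i} {j} i<j → F.ι-strict (ℕ.≰⇒> λ q →
      G.ι-strict i<j (Min.x≤y⇒x⊓y≈x (Fin.≤-totalOrder _) q))
  }
  where
  module F = Embedding f
  module G = Embedding g
  open ChainProperties isChain

finChain-embedding : ∀ {k l} → ℕ.suc k ℕ.≤′ l → Embedding (ℕ.suc k) (FinChain.algebra l)
finChain-embedding ℕ.≤′-refl = record
  { ι        = λ i → i
  ; ι-bot    = refl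
  ; ι-top    = refl
  ; ι-strict = λ i<j p → ℕ.<⇒≱ i<j (finChain-≤ p)
  }
finChain-embedding {l = ℕ.suc (ℕ.suc l)} (ℕ.≤′-step p) =
  _∘ᴱ_ {isChain = FinChain.isDuallyStoneHeytingChain _}
    (finChain-embedding-suc l) (finChain-embedding p)
finChain-embedding {l = ℕ.suc ℕ.zero} (ℕ.≤′-step (ℕ.≤′-reflexive ()))

trivial-⊨ : ∀ e → FinChain.algebra 0 ⊨ e
trivial-⊨ (s , t) ρ = all≡ _ _
  where
  all≡ : (x y : Fin 1) → x ≡ y
  all≡ Fin.zero Fin.zero = refl

finChain-⊨-antitone : ∀ {k l} → k ℕ.≤ l → ∀ e → FinChain.algebra l ⊨ e → FinChain.algebra k ⊨ e
finChain-⊨-antitone {ℕ.zero}  _   e _   = trivial-⊨ e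
finChain-⊨-antitone {ℕ.suc k} k≤l =
  EmbeddingProperties.⊨-reflects (FinChain.isDuallyStoneHeytingChain _)
    (finChain-embedding (ℕ.≤⇒≤′ k≤l))

-- Separation of the finite chains by equations

-- The join of the implications x₍ᵢ₊₁₎ ⇒ xᵢ for i < n. In a chain it differs
-- from 1 only if x₀ < x₁ < … < xₙ.
descent : ℕ → Term
descent ℕ.zero    = `0
descent (ℕ.suc n) = descent n `∨ (var (ℕ.suc n) `⇒ var n)

module _ (k : ℕ) where
  open FinChain k
  open Max (Fin.≤-totalOrder (ℕ.suc k)) using (_⊔_; x≤y⇒x⊔y≈y; x≤y⇒y⊔x≈y; ⊔-lub)

  -- If no implication is 1, the values increase strictly from x₀ on, so the
  -- value of xₙ is at least n.
  descent-cases : ∀ ρ n → ⟦ algebra ⟧ (descent n) ρ ≡ top ⊎ n ℕ.≤ Fin.toℕ (ρ n)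
  descent-cases ρ ℕ.zero    = inj₂ ℕ.z≤n
  descent-cases ρ (ℕ.suc n) =
    [ (λ p → inj₁ (trans (cong (_⊔ next) p) (x≤y⇒y⊔x≈y {top} {next} (≤top next))))
    , step (ρ (ℕ.suc n) Fin.≤? ρ n)
    ]′ (descent-cases ρ n)
    where
    previous next : L
    previous = ⟦ algebra ⟧ (descent n) ρ
    next     = imp (ρ (ℕ.suc n)) (ρ n)

    step : Dec (ρ (ℕ.suc n) Fin.≤ ρ n) → n ℕ.≤ Fin.toℕ (ρ n) →
           previous ⊔ next ≡ top ⊎ ℕ.suc n ℕ.≤ Fin.toℕ (ρ (ℕ.suc n))
    step (yes q) _ = inj₁ (trans (cong (previous ⊔_) (imp-≤ q)) (x≤y⇒x⊔y≈y {top} {previous} (≤top previous)))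
    step (no q)  p = inj₂ (ℕ.≤-<-trans p (ℕ.≰⇒> q))

  descent-valid : algebra ⊨ (descent (ℕ.suc k) , `1)
  descent-valid ρ with descent-cases ρ (ℕ.suc k)
  ... | inj₁ p = p
  ... | inj₂ p = ⊥-elim (ℕ.<⇒≱ (Fin.toℕ<n (ρ (ℕ.suc k))) p)

  descent-increasing : ∀ ρ n → (∀ i → i ℕ.≤ n → ρ i Fin.< ρ (ℕ.suc i)) →
                       ⟦ algebra ⟧ (descent (ℕ.suc n)) ρ Fin.≤ ρ n
  descent-increasing ρ n increasing = ⊔-lub (previous n increasing) last
    where
    last : imp (ρ (ℕ.suc n)) (ρ n) Fin.≤ ρ n
    last with imp-cases (ρ (ℕ.suc n)) (ρ n)
    ... | inj₁ p = ⊥-elim (ℕ.<⇒≱ (increasing n ℕ.≤-refl) p)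
    ... | inj₂ p = ℕ.≤-reflexive (cong Fin.toℕ p)

    previous : ∀ m → (∀ i → i ℕ.≤ m → ρ i Fin.< ρ (ℕ.suc i)) →
               ⟦ algebra ⟧ (descent m) ρ Fin.≤ ρ m
    previous ℕ.zero    _   = bot≤ (ρ 0)
    previous (ℕ.suc m) inc =
      ℕ.≤-trans (descent-increasing ρ m λ i i≤m → inc i (ℕ.m≤n⇒m≤1+n i≤m))
                (ℕ.<⇒≤ (inc m (ℕ.n≤1+n m)))

descent-refuted : ∀ k → ¬ (FinChain.algebra (ℕ.suc k) ⊨ (descent (ℕ.suc k) , `1))
descent-refuted k valid = ℕ.<⇒≱ (ρ-< k ℕ.≤-refl) top≤ρk
  where
  -- The valuation xᵢ = i, constant from the top on.
  ρ : ℕ → Fin (ℕ.suc (ℕ.suc k))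
  ρ i = fromℕ< (ℕ.s≤s (ℕ.m⊓n≤n i (ℕ.suc k)))

  toℕ-ρ : ∀ {i} → i ℕ.≤ ℕ.suc k → Fin.toℕ (ρ i) ≡ i
  toℕ-ρ i≤ = trans (Fin.toℕ-fromℕ< _) (ℕ.m≤n⇒m⊓n≡m i≤)

  ρ-< : ∀ i → i ℕ.≤ k → ρ i Fin.< ρ (ℕ.suc i)
  ρ-< i i≤k = subst₂ ℕ._<_ (sym (toℕ-ρ (ℕ.m≤n⇒m≤1+n i≤k))) (sym (toℕ-ρ (ℕ.s≤s i≤k))) ℕ.≤-refl

  top≤ρk : ρ (ℕ.suc k) Fin.≤ ρ k
  top≤ρk = ℕ.≤-trans (Fin.≤fromℕ _)
    (subst (Fin._≤ ρ k) (valid ρ) (descent-increasing (ℕ.suc k) ρ k ρ-<))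

-- Strictly sorted enumerations

-- Insertion sort for a total preorder, with removal of duplicates up to the
-- induced equivalence.
module Sorting
  {I : Set} (_≼_ : Rel I 0ℓ) (≼-refl : ∀ {x} → x ≼ x) (≼-trans : Transitive _≼_)
  (≼-total : Total _≼_) (_≼?_ : Decidable _≼_) where

  _≺_ _~_ : Rel I 0ℓ
  x ≺ y = ¬ (y ≼ x)
  x ~ y = x ≼ y × y ≼ x

  ≺⇒≼ : ∀ {x y} → x ≺ y → x ≼ y
  ≺⇒≼ {x} {y} x≺y = [ (λ p → p) , (λ q → ⊥-elim (x≺y q)) ]′ (≼-total x y)

  ≺-trans : Transitive _≺_
  ≺-trans x≺y y≺z z≼x = x≺y (≼-trans (≺⇒≼ y≺z) z≼x)

  -- An x equivalent to a listed element is represented by that element.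
  insert : ∀ x {ys} → AllPairs _≺_ ys → ∃ λ zs →
           AllPairs _≺_ zs × zs ⊆ x ∷ ys × ys ⊆ zs × ∃ λ z → z ∈ zs × z ~ x
  insert x [] = x ∷ [] , [] ∷ [] , (λ p → p) , (λ ()) , x , here refl , ≼-refl , ≼-refl
  insert x {y ∷ ys} (y≺ys ∷ sorted) with x ≼? y | y ≼? x
  ... | yes x≼y | yes y≼x =
        y ∷ ys , y≺ys ∷ sorted , there , (λ p → p) , y , here refl , y≼x , x≼y
  ... | _       | no x≺y  =
        x ∷ y ∷ ys , (x≺y ∷ All.map (≺-trans x≺y) y≺ys) ∷ y≺ys ∷ sorted
        , (λ p → p) , there , x , here refl , ≼-refl , ≼-refl
  ... | no y≺x  | _       with insert x sorted
  ...   | zs , zs-sorted , zs⊆ , ⊆zs , z , z∈zs , z~x =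
        y ∷ zs , All.tabulate (y≺zs ∘ zs⊆) ∷ zs-sorted
        , y∷zs⊆ , ⊆y∷zs , z , there z∈zs , z~x
    where
    y≺zs : ∀ {z} → z ∈ x ∷ ys → y ≺ z
    y≺zs (here refl) = y≺x
    y≺zs (there p)   = All.lookup y≺ys p

    y∷zs⊆ : y ∷ zs ⊆ x ∷ y ∷ ys
    y∷zs⊆ (here p)  = there (here p)
    y∷zs⊆ (there p) with zs⊆ p
    ... | here q  = here q
    ... | there q = there (there q)

    ⊆y∷zs : y ∷ ys ⊆ y ∷ zs
    ⊆y∷zs (here p)  = here p
    ⊆y∷zs (there p) = there (⊆zs p)

  enumerate : ∀ xs → ∃ λ zs →
              AllPairs _≺_ zs × zs ⊆ xs × (∀ {x} → x ∈ xs → ∃ λ z → z ∈ zs × z ~ x)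
  enumerate []       = [] , [] , (λ ()) , λ ()
  enumerate (x ∷ xs) with enumerate xs
  ... | ys , ys-sorted , ys⊆ , covers with insert x ys-sorted
  ...   | zs , zs-sorted , zs⊆ , ⊆zs , z , z∈zs , z~x = zs , zs-sorted , zs⊆xs , covers′
    where
    zs⊆xs : zs ⊆ x ∷ xs
    zs⊆xs p with zs⊆ p
    ... | here q  = here q
    ... | there q = there (ys⊆ q)

    covers′ : ∀ {w} → w ∈ x ∷ xs → ∃ λ z → z ∈ zs × z ~ w
    covers′ (here refl) = z , z∈zs , z~x
    covers′ (there p)   = let y , y∈ys , y~w = covers p in y , ⊆zs y∈ys , y~w

AllPairs-lookup : ∀ {I : Set} {R : Rel I 0ℓ} {xs} → AllPairs R xs →
                  ∀ {i j} → i Fin.< j → R (lookup xs i) (lookup xs j)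
AllPairs-lookup (r ∷ rs) {Fin.zero}  {Fin.suc j} _   = All.lookup r (∈-lookup j)
AllPairs-lookup (r ∷ rs) {Fin.suc i} {Fin.suc j} i<j = AllPairs-lookup rs (ℕ.s≤s⁻¹ i<j)

-- Variables and substitution

-- The variables of a term, with repetitions.
vars : Term → List ℕ
vars (var i)  = i ∷ []
vars (s `∨ t) = vars s ++ vars t
vars (s `∧ t) = vars s ++ vars t
vars (s `⇒ t) = vars s ++ vars t
vars (t `′)   = vars t
vars `0       = []
vars `1       = []

infix 9 _⟪_⟫

-- Simultaneous substitution.
_⟪_⟫ : Term → (ℕ → Term) → Term
var i    ⟪ τ ⟫ = τ i
(s `∨ t) ⟪ τ ⟫ = s ⟪ τ ⟫ `∨ t ⟪ τ ⟫
(s `∧ t) ⟪ τ ⟫ = s ⟪ τ ⟫ `∧ t ⟪ τ ⟫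
(s `⇒ t) ⟪ τ ⟫ = s ⟪ τ ⟫ `⇒ t ⟪ τ ⟫
(t `′)   ⟪ τ ⟫ = t ⟪ τ ⟫ `′
`0       ⟪ τ ⟫ = `0
`1       ⟪ τ ⟫ = `1

module _ (A : Algebra) where
  open Algebra A
  open IsEquivalence ≈-isEquivalence renaming (refl to ≈-refl)

  ⟦⟧-cong : ∀ t {ρ ρ′} → (∀ {i} → i ∈ vars t → ρ i ≈ ρ′ i) → ⟦ A ⟧ t ρ ≈ ⟦ A ⟧ t ρ′
  ⟦⟧-cong (var i)  h = h (here refl)
  ⟦⟧-cong (s `∨ t) h = ∨-congruent (⟦⟧-cong s (h ∘ ∈-++⁺ˡ)) (⟦⟧-cong t (h ∘ ∈-++⁺ʳ (vars s)))
  ⟦⟧-cong (s `∧ t) h = ∧-congruent (⟦⟧-cong s (h ∘ ∈-++⁺ˡ)) (⟦⟧-cong t (h ∘ ∈-++⁺ʳ (vars s)))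
  ⟦⟧-cong (s `⇒ t) h = ⇒-congruent (⟦⟧-cong s (h ∘ ∈-++⁺ˡ)) (⟦⟧-cong t (h ∘ ∈-++⁺ʳ (vars s)))
  ⟦⟧-cong (t `′)   h = ′-congruent (⟦⟧-cong t h)
  ⟦⟧-cong `0       h = ≈-refl
  ⟦⟧-cong `1       h = ≈-refl

  ⟦⟧-⟪⟫ : ∀ t τ ρ → ⟦ A ⟧ (t ⟪ τ ⟫) ρ ≡ ⟦ A ⟧ t (λ i → ⟦ A ⟧ (τ i) ρ)
  ⟦⟧-⟪⟫ (var i)  τ ρ = refl
  ⟦⟧-⟪⟫ (s `∨ t) τ ρ = cong₂ _∨_ (⟦⟧-⟪⟫ s τ ρ) (⟦⟧-⟪⟫ t τ ρ)
  ⟦⟧-⟪⟫ (s `∧ t) τ ρ = cong₂ _∧_ (⟦⟧-⟪⟫ s τ ρ) (⟦⟧-⟪⟫ t τ ρ)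
  ⟦⟧-⟪⟫ (s `⇒ t) τ ρ = cong₂ _⇒_ (⟦⟧-⟪⟫ s τ ρ) (⟦⟧-⟪⟫ t τ ρ)
  ⟦⟧-⟪⟫ (t `′)   τ ρ = cong _′ (⟦⟧-⟪⟫ t τ ρ)
  ⟦⟧-⟪⟫ `0       τ ρ = refl
  ⟦⟧-⟪⟫ `1       τ ρ = refl

-- Finitely generated subalgebras of chains

-- In a chain the subalgebra generated by the values of some variables consists
-- of those values and the two bounds, that is, of the values of these terms.
generators : List ℕ → List Term
generators vs = `0 ∷ `1 ∷ map var vs

-- A finite chain isomorphic to the subalgebra of B generated by the values
-- under ρ of the variables vs: each of its elements is named by a generator, and
-- σ is the valuation that corresponds to ρ on vs (arbitrary elsewhere).
record Generated (B : Algebra) (ρ : ℕ → Algebra.Carrier B) (vs : List ℕ) : Set where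
  open Algebra B
  field
    size  : ℕ
    emb   : Embedding size B
  open Embedding emb public
  field
    name  : Fin (ℕ.suc size) → Term
    name∈ : ∀ i → name i ∈ generators vs
    ι≡    : ∀ i → ι i ≡ ⟦ B ⟧ (name i) ρ
    σ     : ℕ → Fin (ℕ.suc size)
    ι∘σ≈ρ : ∀ {v} → v ∈ vs → ι (σ v) ≈ ρ v

-- Entailment between equations over the chains

-- In a chain, Δ t is 1 where t is 1, and 0 elsewhere.
Δ : Term → Term
Δ t = (t `′) `′

infix 5 _`⇔_

-- In a Heyting algebra, s ⇔ t is 1 exactly where s and t agree.
_`⇔_ : Term → Term → Term
s `⇔ t = (s `⇒ t) `∧ (t `⇒ s)

⋀ : List Term → Term
⋀ = foldr _`∧_ `1

-- All vectors of length n with entries from a list.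
tuples : ∀ {I : Set} → List I → ∀ n → List (Vec I n)
tuples xs ℕ.zero    = Vec.[] ∷ []
tuples xs (ℕ.suc n) = cartesianProductWith Vec._∷_ xs (tuples xs n)

∈-tuples : ∀ {I : Set} {xs : List I} {n} (f : Fin n → I) → (∀ i → f i ∈ xs) →
           Vec.tabulate f ∈ tuples xs n
∈-tuples {n = ℕ.zero}  f h = here refl
∈-tuples {n = ℕ.suc n} f h =
  ∈-cartesianProductWith⁺ Vec._∷_ (h Fin.zero) (∈-tuples (f ∘ Fin.suc) (h ∘ Fin.suc))

-- The conjunction, over all maps v from Fin n to the generators, of the
-- assertions that p ≈ q holds after each variable i is replaced by v (σ i).
-- Factoring through σ makes the number of substitutions finite.
instances : ∀ {n} → Equation → (ℕ → Fin n) → List ℕ → Term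
instances {n} (p , q) σ vs =
  ⋀ (map (λ v → Δ ((p `⇔ q) ⟪ Vec.lookup v ∘ σ ⟫)) (tuples (generators vs) n))

module _ {B : Algebra} (isChain : IsDuallyStoneHeytingChain B) where
  open Algebra B
  open ChainProperties isChain

  ⋀-0 : ∀ {ts t} ρ → t ∈ ts → ⟦ B ⟧ t ρ ≈ 0# → ⟦ B ⟧ (⋀ ts) ρ ≈ 0#
  ⋀-0 ρ (here refl) p = ≈-trans (∧-congruent p ≈-refl) (0∧x≈0 _)
  ⋀-0 ρ (there i)   p = ≈-trans (∧-congruent ≈-refl (⋀-0 ρ i p)) (x∧0≈0 _)

  ⇔≈1⇒≈ : ∀ {x y} → (x ⇒ y) ∧ (y ⇒ x) ≈ 1# → x ≈ y
  ⇔≈1⇒≈ {x} {y} p = ≤-antisym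
    (⇒≈1⇒≤ (1≤x⇒x≈1 (≤-trans (≤-reflexive (≈-sym p)) x∧y≤x)))
    (⇒≈1⇒≤ (1≤x⇒x≈1 (≤-trans (≤-reflexive (≈-sym p)) x∧y≤y)))
    where
    x∧y≤y : ∀ {x y} → x ∧ y ≤ y
    x∧y≤y {x} {y} = ≈-trans (∧-assoc x y y) (∧-congruent ≈-refl (∧-idem y))
    x∧y≤x : ∀ {x y} → x ∧ y ≤ x
    x∧y≤x {x} {y} = ≤-trans (≤-reflexive (∧-comm x y)) x∧y≤y

  -- It suffices that one of the instances fails at ρ.
  instances≈0 : ∀ {n} p q (σ : ℕ → Fin n) vs ρ (name : Fin n → Term) →
                (∀ i → name i ∈ generators vs) →
                let ρ′ = λ i → ⟦ B ⟧ (name (σ i)) ρ in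
                ¬ (⟦ B ⟧ p ρ′ ≈ ⟦ B ⟧ q ρ′) → ⟦ B ⟧ (instances (p , q) σ vs) ρ ≈ 0#
  instances≈0 p q σ vs ρ name name∈ p≉q =
    ⋀-0 ρ (∈-map⁺ (λ v → Δ ((p `⇔ q) ⟪ Vec.lookup v ∘ σ ⟫)) (∈-tuples name name∈))
      (≉1⇒″≈0 λ h → p≉q (⇔≈1⇒≈ (≈-trans name-values
        (≈-trans (≈-reflexive (sym (⟦⟧-⟪⟫ B (p `⇔ q) _ ρ))) h))))
    where
    name-values : ⟦ B ⟧ (p `⇔ q) (λ i → ⟦ B ⟧ (name (σ i)) ρ) ≈
                  ⟦ B ⟧ (p `⇔ q) (λ i → ⟦ B ⟧ (Vec.lookup (Vec.tabulate name) (σ i)) ρ)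
    name-values = ⟦⟧-cong B (p `⇔ q) λ {i} _ →
      ≈-reflexive (cong (λ r → ⟦ B ⟧ r ρ) (sym (Vec.lookup∘tabulate name (σ i))))

-- The algebra A need not be a chain here; it only satisfies the equations
-- that hold in all chains.
module _ (A : Algebra) (A∈DStHC : A ∈ᶜ DStHC) where
  open Algebra A
  open IsEquivalence ≈-isEquivalence renaming (sym to ≈-sym; trans to ≈-trans)

  private
    1∧x≈x : ∀ x → 1# ∧ x ≈ x
    1∧x≈x x = A∈DStHC (`1 `∧ var 0 , var 0)
      (λ B B-chain ρ → proj₁ (ChainProperties.∧-identity B-chain) (ρ 0)) (λ _ → x)

    x⇒x≈1ᴬ : ∀ x → x ⇒ x ≈ 1#
    x⇒x≈1ᴬ x = A∈DStHC (var 0 `⇒ var 0 , `1)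
      (λ B B-chain ρ → ChainProperties.x⇒x≈1 B-chain (ρ 0)) (λ _ → x)

    1″≈1 : (1# ′) ′ ≈ 1#
    1″≈1 = A∈DStHC (Δ `1 , `1)
      (λ B B-chain ρ → let open ChainProperties B-chain in
        IsEquivalence.trans (Algebra.≈-isEquivalence B) (Algebra.′-congruent B 1′≈0) 0′≈1)
      (λ _ → 1#)

  Δ⇔≈1 : ∀ {x y} → x ≈ y → (((x ⇒ y) ∧ (y ⇒ x)) ′) ′ ≈ 1#
  Δ⇔≈1 {x} {y} x≈y = ≈-trans (′-congruent (′-congruent ⇔≈1ᴬ)) 1″≈1
    where
    ⇔≈1ᴬ : (x ⇒ y) ∧ (y ⇒ x) ≈ 1#
    ⇔≈1ᴬ = ≈-trans
      (∧-congruent (≈-trans (⇒-congruent x≈y (IsEquivalence.refl ≈-isEquivalence)) (x⇒x≈1ᴬ y))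
                   (≈-trans (⇒-congruent (≈-sym x≈y) (IsEquivalence.refl ≈-isEquivalence)) (x⇒x≈1ᴬ x)))
      (1∧x≈x 1#)

  ⋀-map≈1 : ∀ {I : Set} (f : I → Term) xs ρ → (∀ x → ⟦ A ⟧ (f x) ρ ≈ 1#) →
            ⟦ A ⟧ (⋀ (map f xs)) ρ ≈ 1#
  ⋀-map≈1 f []       ρ h = IsEquivalence.refl ≈-isEquivalence
  ⋀-map≈1 f (x ∷ xs) ρ h = ≈-trans (∧-congruent (h x) (⋀-map≈1 f xs ρ h)) (1∧x≈x 1#)

  instances≈1 : ∀ {n} p q (σ : ℕ → Fin n) vs → A ⊨ (p , q) →
                ∀ ρ → ⟦ A ⟧ (instances (p , q) σ vs) ρ ≈ 1#
  instances≈1 p q σ vs A⊨ ρ =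
    ⋀-map≈1 (λ v → Δ ((p `⇔ q) ⟪ Vec.lookup v ∘ σ ⟫)) (tuples (generators vs) _) ρ λ v →
    let τ = Vec.lookup v ∘ σ in
    Δ⇔≈1 (subst₂ _≈_ (sym (⟦⟧-⟪⟫ A p τ ρ)) (sym (⟦⟧-⟪⟫ A q τ ρ)) (A⊨ _))

  relative⇒absolute : ∀ s t u → (∀ ρ → ⟦ A ⟧ u ρ ≈ 1#) → A ⊨ (u `∧ s , u `∧ t) → A ⊨ (s , t)
  relative⇒absolute s t u u≈1 A⊨ ρ = ≈-trans (≈-sym (drop _)) (≈-trans (A⊨ ρ) (drop _))
    where
    drop : ∀ x → ⟦ A ⟧ u ρ ∧ x ≈ x
    drop x = ≈-trans (∧-congruent (u≈1 ρ) (IsEquivalence.refl ≈-isEquivalence)) (1∧x≈x x)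

-- Consequences of excluded middle: subvarieties of DStHC

module Classical (em : ExcludedMiddle (suc 0ℓ)) where

  em₀ : {P : Set} → Dec P
  em₀ = map′ lower lift em

  -- Sorting the generators by their values lists the subalgebra in
  -- increasing order.
  generate : ∀ {B} → IsDuallyStoneHeytingChain B → ∀ ρ vs → Generated B ρ vs
  generate {B} isChain ρ vs with enumerate (generators vs)
    where
    open Algebra B
    open ChainProperties isChain
    open Sorting {I = Term} (λ s t → ⟦ B ⟧ s ρ ≤ ⟦ B ⟧ t ρ)
      ≤-refl ≤-trans (λ s t → ≤-total _ _) (λ _ _ → em₀)
  ... | [] , _ , _ , covers with () ← proj₁ (proj₂ (covers (here refl)))
  ... | z ∷ zs , sorted , zs⊆ , covers = record
    { size  = length zs
    ; emb   = record
      { ι        = ι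
      ; ι-bot    = let i , p = position (here refl) in
                   ≤-antisym (≤-trans (ι-mono {j = i} ℕ.z≤n) (≤-reflexive p)) (0∧x≈0 _)
      ; ι-top    = let i , p = position (there (here refl)) in
                   1≤x⇒x≈1 (≤-trans (≤-reflexive (≈-sym p)) (ι-mono (Fin.≤fromℕ i)))
      ; ι-strict = ι-strict
      }
    ; name  = lookup (z ∷ zs)
    ; name∈ = λ i → zs⊆ (∈-lookup i)
    ; ι≡    = λ i → refl
    ; σ     = λ v → proj₁ (value v)
    ; ι∘σ≈ρ = λ {v} → proj₂ (value v)
    }
    where
    open Algebra B
    open ChainProperties isChain
    open DecMembership ℕ._≟_ using (_∈?_)

    ι : Fin (ℕ.suc (length zs)) → Carrier
    ι i = ⟦ B ⟧ (lookup (z ∷ zs) i) ρ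

    ι-strict : ∀ {i j} → i Fin.< j → ¬ (ι j ≤ ι i)
    ι-strict = AllPairs-lookup sorted

    ι-mono : ∀ {i j} → i Fin.≤ j → ι i ≤ ι j
    ι-mono = strict⇒monotone {ι = ι} ι-strict

    position : ∀ {t} → t ∈ generators vs → ∃ λ i → ι i ≈ ⟦ B ⟧ t ρ
    position t∈ with covers t∈
    ... | w , w∈zs , w≤t , t≤w =
      index w∈zs
      , ≈-trans (≈-reflexive (cong (λ r → ⟦ B ⟧ r ρ) (sym (lookup-index w∈zs)))) (≤-antisym w≤t t≤w)

    value : ∀ v → ∃ λ i → v ∈ vs → ι i ≈ ρ v
    value v with v ∈? vs
    ... | no v∉  = Fin.zero , λ v∈ → ⊥-elim (v∉ v∈)
    ... | yes v∈ = let i , p = position (there (there (∈-map⁺ var v∈))) in i , λ _ → p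

  generated-⊨ : ∀ {B} → IsDuallyStoneHeytingChain B → ∀ {ρ} s t →
                (g : Generated B ρ (vars s ++ vars t)) →
                FinChain.algebra (Generated.size g) ⊨ (s , t) →
                Algebra._≈_ B (⟦ B ⟧ s ρ) (⟦ B ⟧ t ρ)
  generated-⊨ {B} isChain {ρ} s t g finite⊨ = begin
    ⟦ B ⟧ s ρ        ≈⟨ ⟦⟧-cong B s (ι∘σ≈ρ ∘ ∈-++⁺ˡ) ⟨
    ⟦ B ⟧ s (ι ∘ σ)  ≈⟨ ι-⟦⟧ s σ ⟨
    ι (⟦ C ⟧ s σ)    ≡⟨ cong ι (finite⊨ σ) ⟩
    ι (⟦ C ⟧ t σ)    ≈⟨ ι-⟦⟧ t σ ⟩
    ⟦ B ⟧ t (ι ∘ σ)  ≈⟨ ⟦⟧-cong B t (ι∘σ≈ρ ∘ ∈-++⁺ʳ (vars s)) ⟩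
    ⟦ B ⟧ t ρ        ∎
    where
    open Generated g
    open EmbeddingProperties isChain emb
    open SetoidReasoning (ChainProperties.setoid isChain)
    C : Algebra
    C = FinChain.algebra size

  -- DStHC is generated by its finite chains.
  finChains-generate : ∀ e → (∀ k → FinChain.algebra k ⊨ e) → e ∈ᶜ Id IsDuallyStoneHeytingChain
  finChains-generate (s , t) finite⊨ B isChain ρ = generated-⊨ isChain s t g (finite⊨ _)
    where
    g = generate isChain ρ (vars s ++ vars t)

  -- Relative to the instances u of an equation p ≈ q that fails in the chain
  -- with k + 2 elements, every equation of the chain with k + 1 elements
  -- holds in all chains.
  entailment : ∀ {k} p q s t → FinChain.algebra k ⊨ (s , t) →
               (σ : ℕ → Fin (ℕ.suc (ℕ.suc k))) →
               let C = FinChain.algebra (ℕ.suc k)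
                   u = instances (p , q) σ (vars s ++ vars t) in
               ¬ (⟦ C ⟧ p σ ≡ ⟦ C ⟧ q σ) →
               (u `∧ s , u `∧ t) ∈ᶜ Id IsDuallyStoneHeytingChain
  entailment {k} p q s t C⊨ σ refutes B isChain ρ with em₀ {Algebra._≈_ B (⟦ B ⟧ s ρ) (⟦ B ⟧ t ρ)}
  ... | yes s≈t = Algebra.∧-congruent B (ChainProperties.≈-refl isChain) s≈t
  ... | no s≉t  = ≈-trans (u∧x≈0 _) (≈-sym (u∧x≈0 _))
    where
    open Algebra B
    open ChainProperties isChain
    vs = vars s ++ vars t
    u = instances (p , q) σ vs
    g : Generated B ρ vs
    g = generate isChain ρ vs
    module G = Generated g

    -- Otherwise the generated subalgebra would satisfy s ≈ t.
    k<size : k ℕ.< G.size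
    k<size = ℕ.≰⇒> λ size≤k →
      s≉t (generated-⊨ isChain s t g (finChain-⊨-antitone size≤k (s , t) C⊨))

    inner : Embedding (ℕ.suc k) (FinChain.algebra G.size)
    inner = finChain-embedding (ℕ.≤⇒≤′ k<size)

    outer : Embedding (ℕ.suc k) B
    outer = _∘ᴱ_ {isChain = isChain} G.emb inner

    name : Fin (ℕ.suc (ℕ.suc k)) → Term
    name = G.name ∘ Embedding.ι inner

    named : ∀ r → ⟦ B ⟧ r (λ i → ⟦ B ⟧ (name (σ i)) ρ) ≈ ⟦ B ⟧ r (Embedding.ι outer ∘ σ)
    named r = ⟦⟧-cong B r λ _ → ≈-reflexive (sym (G.ι≡ _))

    u≈0 : ⟦ B ⟧ u ρ ≈ 0#
    u≈0 = instances≈0 isChain p q σ vs ρ name (λ i → G.name∈ _) λ p≈q →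
      refutes (EmbeddingProperties.ι-reflects isChain outer p q σ
        (≈-trans (≈-sym (named p)) (≈-trans p≈q (named q))))

    u∧x≈0 : ∀ x → ⟦ B ⟧ u ρ ∧ x ≈ 0#
    u∧x≈0 x = ≈-trans (∧-congruent u≈0 ≈-refl) (0∧x≈0 x)

  refute : ∀ A p q → ¬ (A ⊨ (p , q)) →
           ∃ λ ρ → ¬ (Algebra._≈_ A (⟦ A ⟧ p ρ) (⟦ A ⟧ q ρ))
  refute A p q ¬⊨ = decidable-stable em₀ λ none → ¬⊨ λ ρ → decidable-stable em₀ λ ≉ → none (ρ , ≉)

  -- Either P holds everywhere, or it holds somewhere and fails one step later.
  all-or-last : (P : ℕ → Set₁) → P 0 → (∀ n → P n) ⊎ (∃ λ n → P n × ¬ P (ℕ.suc n))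
  all-or-last P P0 with em {∃ λ n → P n × ¬ P (ℕ.suc n)}
  ... | yes last = inj₂ last
  ... | no none  = inj₁ all
    where
    all : ∀ n → P n
    all ℕ.zero    = P0
    all (ℕ.suc n) = decidable-stable em λ ¬P → none (n , all n , ¬P)

  module _ (X : Subvariety DStHC) where
    open Subvariety X
    private
      E : Pred Equation (suc 0ℓ)
      E = proj₁ isVariety
      ∈X⇒⊨ : ∀ {A} → class A → Mod E A
      ∈X⇒⊨ = proj₁ (proj₂ isVariety)
      ⊨⇒∈X : ∀ {A} → Mod E A → class A
      ⊨⇒∈X = proj₂ (proj₂ isVariety)
      open Lattice subvarietiesOfDStHC using (_≈_)

    all⇒≈DStHC : (∀ k → class (FinChain.algebra k)) → chain ⊤⁺ ≈ X
    all⇒≈DStHC all∈X =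
      (λ A∈ → ⊨⇒∈X λ e e∈E → A∈ e (finChains-generate e λ k → ∈X⇒⊨ (all∈X k) e e∈E))
      , ⊆-base

    last⇒≈V : ∀ k → class (FinChain.algebra k) → ¬ class (FinChain.algebra (ℕ.suc k)) →
              chain [ k ] ≈ X
    last⇒≈V k k∈X k+1∉X = V-least _ isVariety (λ { refl → k∈X }) , X⊆V
      where
      failing : ∃ λ e → e ∈ᶜ E × ¬ (FinChain.algebra (ℕ.suc k) ⊨ e)
      failing = decidable-stable em λ none → k+1∉X (⊨⇒∈X λ e e∈E →
        decidable-stable em₀ λ ¬⊨ → none (e , e∈E , ¬⊨))

      X⊆V : class ⊆ᶜ V ｛ FinChain.algebra k ｝
      X⊆V {A} A∈X (s , t) e∈Id with failing
      ... | (p , q) , f∈E , ¬⊨ with refute (FinChain.algebra (ℕ.suc k)) p q ¬⊨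
      ...   | σ , refutes = relative⇒absolute A A∈DStHC s t u
                (instances≈1 A A∈DStHC p q σ vs (∈X⇒⊨ A∈X (p , q) f∈E))
                (A∈DStHC (u `∧ s , u `∧ t) (entailment p q s t (e∈Id _ refl) σ refutes))
        where
        A∈DStHC = ⊆-base A∈X
        vs = vars s ++ vars t
        u = instances (p , q) σ vs

    chain-covers : ∃ λ x → chain x ≈ X
    chain-covers with all-or-last (λ k → class (FinChain.algebra k)) (⊨⇒∈X λ e _ → trivial-⊨ e)
    ... | inj₁ all               = ⊤⁺ , all⇒≈DStHC all
    ... | inj₂ (k , k∈X , k+1∉X) = [ k ] , last⇒≈V k k∈X k+1∉X

-- The order on the varieties generated by finite chains

open Lattice subvarietiesOfDStHC using () renaming (_≤_ to _≤ˢ_)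

chain-mono : ∀ {x y} → x ≤⁺ y → chain x ≤ˢ chain y
chain-mono [ k≤l ]     A∈V e e∈Id =
  A∈V e λ { _ refl → finChain-⊨-antitone k≤l e (e∈Id _ refl) }
chain-mono ([ k ] ≤⊤⁺) {A} = Subvariety.⊆-base (chain [ k ]) {A}
chain-mono (⊤⁺ ≤⊤⁺)    A∈  = A∈

longer-∉V : ∀ k → ¬ Subvariety.class (chain [ k ]) (FinChain.algebra (ℕ.suc k))
longer-∉V k ∈V =
  descent-refuted k (∈V (descent (ℕ.suc k) , `1) λ { _ refl → descent-valid k })

chain-cancel : ∀ {x y} → chain x ≤ˢ chain y → x ≤⁺ y
chain-cancel {x}     {⊤⁺}    _ = x ≤⊤⁺
chain-cancel {⊤⁺}    {[ l ]} h =
  ⊥-elim (longer-∉V l (h {C} (⊆-V IsDuallyStoneHeytingChain {C} (Cᵈᵖ-isChain (ℕ.suc (ℕ.suc l))))))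
  where
  C = FinChain.algebra (ℕ.suc l)
chain-cancel {[ k ]} {[ l ]} h with k ℕ.≤? l
... | yes k≤l = [ k≤l ]
... | no k≰l  = ⊥-elim (longer-∉V l (h {C} (chain-mono [ ℕ.≰⇒> k≰l ] {C} (⊆-V ｛ C ｝ {C} refl))))
  where
  C = FinChain.algebra (ℕ.suc l)

theorem4p6 : ExcludedMiddle (suc 0ℓ) →
    let open Lattice subvarietiesOfDStHC in
    IsOrderIsomorphism (_≡_ {A = ℕ ⁺}) _≈_ _≤⁺_ _≤_ chain
theorem4p6 em = record
  { isOrderMonomorphism = record
    { isOrderHomomorphism = record
      { cong = λ { refl → (λ A∈ → A∈) , (λ A∈ → A∈) }
      ; mono = chain-mono
      }
    ; injective = λ (p , q) → ≤⁺-antisym-≡ ℕ.≤-antisym (chain-cancel p) (chain-cancel q)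
    ; cancel    = chain-cancel
    }
  ; surjective = λ X → let x , x≈X = Classical.chain-covers em X in x , λ { refl → x≈X }
  }
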